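{- Let $(x_k)_{k\ge0}$ be indeterminates, define $a_n=x_n$ if $n=2^k-1$ for some integer $k\ge0$ and $a_n=0$ otherwise, and let $D(n)=\det\left(a_{i+j+1}\right)_{i,j=0}^{n-1}$ with $D(0)=1$. For $k\ge1$ and $n\ge0$ let $\mu_k(n)$ be the degree of $D(n)$ in the variable $x_{2^k-1}$. Then for every $k\ge1$ and $0\le i\le 2^{k-1}-1$: $$\mu_k(i)=0,\quad \mu_k(2^{k-1}+i)=2i+1,\quad \mu_k(2^k+i)=2^k-2i-1,\quad \mu_k(2^k+2^{k-1}+i)=0,$$ and for $n\ge 2^{k+1}$, $\mu_k(n)=\mu_k(n\bmod 2^{k+1})$.
   Context: The paper writes $D(n)=(-1)^{\sum_i\binom{\mu_i(n)}{2}}\prod_{i\ge1}x_{2^i-1}^{\mu_i(n)}$, so $\mu_i(n)$ is the exponent of $x_{2^i-1}$ in $D(n)$. -}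

module Defs where

open import Algebra.Bundles.Raw using (RawRing)
import Algebra.Definitions.RawSemiring as RawSemiringDefinitions
open import Data.Bool.Base using (if_then_else_)
open import Data.Fin.Base using (Fin; zero; suc; toℕ; punchIn)
open import Data.Integer.Base as ℤ using (ℤ; 0ℤ; 1ℤ)
import Data.Integer.Properties as ℤ
open import Data.List.Base using (List; []; _∷_; _++_; map; filter; length; foldr; cartesianProductWith)
open import Data.List.Membership.Propositional using (_∈_)
open import Data.List.Membership.Propositional.Properties using (∈-++⁺ˡ; ∈-++⁺ʳ)
open import Data.List.Membership.DecPropositional using () renaming (_∈?_ to member?)
open import Data.List.Properties using (filter-none)
open import Data.List.Relation.Unary.All as All using (All)
open import Data.List.Relation.Unary.All.Properties using (¬Any⇒All¬)
open import Data.Maybe.Base using (Maybe; just; nothing)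
open import Data.Nat.Base using (ℕ; zero; suc; _+_; _∸_; _^_; _⊔_; _≤_; _<_; z≤n; s≤s)
open import Data.Nat.Properties using (_≟_; anyUpTo?; m^n>0; +-mono-≤; +-identityʳ; ∸-monoˡ-≤; ≤-reflexive; module ≤-Reasoning)
open import Data.Product.Base using (∃-syntax; _×_; _,_; proj₂)
open import Function.Base using (_∘_)
open import Level using (0ℓ)
open import Relation.Binary.PropositionalEquality using (_≡_; sym; trans; cong; subst)
open import Relation.Nullary using (Dec; does; yes; no; ¬_; ¬?)
open import Relation.Nullary.Decidable using (map′)

-- Laplace expansion along the first row.

module _ {c ℓ} (R : RawRing c ℓ) where
  open RawRing R using (Carrier; 1#; -_; rawSemiring) renaming (_*_ to _·_)
  open RawSemiringDefinitions rawSemiring using (sum) renaming (_^_ to _^ᴿ_)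

  det : ∀ n → (Fin n → Fin n → Carrier) → Carrier
  det zero    M = 1#
  det (suc n) M = sum λ j →
    ((- 1#) ^ᴿ toℕ j) · (M zero j · det n (λ r s → M (suc r) (punchIn j s)))

-- The polynomial ring ℤ[x₀, x₁, x₂, …].
--
-- A monomial is the list of indices of its variables, with multiplicity:
-- x₁²x₃ is 1 ∷ 1 ∷ 3 ∷ [].  The order of the list is immaterial, so monomials
-- are compared by their exponents.

Monomial : Set
Monomial = List ℕ

exponent : ℕ → Monomial → ℕ
exponent v m = length (filter (v ≟_) m)

_≈ₘ_ : Monomial → Monomial → Set
m ≈ₘ m′ = ∀ v → exponent v m ≡ exponent v m′

exponent-∉ : ∀ v m → ¬ (v ∈ m) → exponent v m ≡ 0
exponent-∉ v m v∉m = cong length (filter-none (v ≟_) (¬Any⇒All¬ m v∉m))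

_≈ₘ?_ : ∀ m m′ → Dec (m ≈ₘ m′)
m ≈ₘ? m′ = map′ everywhere (λ eq → All.tabulate (λ {v} _ → eq v))
                (All.all? (λ v → exponent v m ≟ exponent v m′) (m ++ m′))
  where
  everywhere : All (λ v → exponent v m ≡ exponent v m′) (m ++ m′) → m ≈ₘ m′
  everywhere agree v with member? _≟_ v (m ++ m′)
  ... | yes v∈ = All.lookup agree v∈
  ... | no  v∉ = trans (exponent-∉ v m (v∉ ∘ ∈-++⁺ˡ))
                       (sym (exponent-∉ v m′ (v∉ ∘ ∈-++⁺ʳ m)))

-- A polynomial is a formal sum of terms.  Terms may repeat or cancel, so its
-- meaning, equality and degree are all given by the total coefficients.

Term : Set
Term = ℤ × Monomial

Poly : Set
Poly = List Term

coeff : Monomial → Poly → ℤ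
coeff m []             = 0ℤ
coeff m ((c , m′) ∷ p) =
  if does (m ≈ₘ? m′) then c ℤ.+ coeff m p else coeff m p

_*ₜ_ : Term → Term → Term
(c , m) *ₜ (d , m′) = c ℤ.* d , m ++ m′

polyRing : RawRing 0ℓ 0ℓ
polyRing = record
  { Carrier = Poly
  ; _≈_     = λ p q → ∀ m → coeff m p ≡ coeff m q
  ; _+_     = _++_
  ; _*_     = cartesianProductWith _*ₜ_
  ; -_      = map (λ (c , m) → ℤ.- c , m)
  ; 0#      = []
  ; 1#      = (1ℤ , []) ∷ []
  }

x : ℕ → Poly
x v = (1ℤ , v ∷ []) ∷ []

support : Poly → List Monomial
support p = filter (λ m → ¬? (coeff m p ℤ.≟ 0ℤ)) (map proj₂ p)

maximum : List ℕ → Maybe ℕ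
maximum []       = nothing
maximum (n ∷ ns) = just (foldr _⊔_ n ns)

-- The degree of the zero polynomial is `nothing`.
degree : ℕ → Poly → Maybe ℕ
degree v p = maximum (map (exponent v) (support p))

-- Truncated subtraction is harmless here since 2 ^ k ≥ 1.
IsPowerOf2-1 : ℕ → Set
IsPowerOf2-1 n = ∃[ k ] n ≡ 2 ^ k ∸ 1

k<2^k : ∀ k → k < 2 ^ k
k<2^k zero    = s≤s z≤n
k<2^k (suc k) = begin-strict
  suc k               <⟨ s≤s (k<2^k k) ⟩
  1 + 2 ^ k           ≤⟨ +-mono-≤ (m^n>0 2 k) (≤-reflexive (sym (+-identityʳ (2 ^ k)))) ⟩
  2 ^ k + (2 ^ k + 0) ∎
  where
  open ≤-Reasoning

isPowerOf2-1? : ∀ n → Dec (IsPowerOf2-1 n)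
isPowerOf2-1? n = map′ (λ (k , _ , eq) → k , eq)
                       (λ (k , eq) → k , bound k eq , eq)
                       (anyUpTo? (λ k → n ≟ 2 ^ k ∸ 1) (suc n))
  where
  bound : ∀ k → n ≡ 2 ^ k ∸ 1 → k < suc n
  bound k eq = s≤s (subst (k ≤_) (sym eq) (∸-monoˡ-≤ 1 (k<2^k k)))

a : ℕ → Poly
a n = if does (isPowerOf2-1? n) then x n else RawRing.0# polyRing

D : ℕ → Poly
D n = det polyRing n (λ i j → a (toℕ i + toℕ j + 1))

μ : ℕ → ℕ → Maybe ℕ
μ k n = degree (2 ^ k ∸ 1) (D n)

{-# OPTIONS --safe #-}
module Submission where

-- Numbering rows and columns from 1, the (i, j) entry of the matrix of D(n) is
-- nonzero exactly when i + j is a power of two.  If n = c + 2i + 1 with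
-- c + i + 1 = 2ᵐ, a permutation with nonzero entries must reverse the interval
-- (c, n], since n + c + 1 = 2ᵐ⁺¹ is the only available sum for rows and columns
-- ≥ 2ᵐ, and so restricts to {1, …, c}.  Hence exactly one permutation
-- contributes, and D(n) = ± x^(2i+1) D(c) with x of index 2ᵐ⁺¹ − 1.  The values
-- of μₖ follow, and so does its periodicity: c ≡ −1 − n mod 2ᵏ⁺¹ for m > k, and
-- μₖ is invariant under b ↦ 2ᵏ⁺¹ − 1 − b.

open import Defs
open import Algebra.Bundles.Raw using (RawRing)
import Algebra.Definitions.RawSemiring as RawSemiringDefinitions
open import Data.Bool.Base using (if_then_else_)
open import Data.Fin.Base as Fin using (Fin; zero; suc; toℕ; fromℕ<; punchIn)
open import Data.Fin.Permutation using (Permutation′; permutation; _⟨$⟩ʳ_; _⟨$⟩ˡ_; inverseˡ; inverseʳ; remove; insert; insert-punchIn; punchIn-permute) renaming (id to idₚ)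
import Data.Fin.Properties as Fin
open import Data.Integer.Base as ℤ using (0ℤ; 1ℤ)
import Data.Integer.Properties as ℤ
open import Data.List.Base using (List; []; _∷_; _++_; filter; length; replicate; tabulate; applyUpTo)
open import Data.List.Membership.Propositional using (_∈_)
open import Data.List.Membership.Propositional.Properties using (∈-++⁻; ∈-cartesianProductWith⁻)
open import Data.List.Properties using (++-identityʳ; filter-++; filter-all; filter-none; length-++; length-replicate)
open import Data.List.Relation.Unary.All.Properties using (replicate⁺)
open import Data.List.Relation.Unary.Any using (here)
open import Data.Maybe.Base using (just)
open import Data.Nat.Base using (ℕ; zero; suc; _+_; _*_; _∸_; _^_; _/_; _%_; _≤_; _<_; _≥_; z≤n; s≤s; NonZero)
open import Data.Nat.Divisibility using (_∣_; divides; n∣m*n; ∣m+n∣m⇒∣n)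
open import Data.Nat.DivMod using (m<n⇒m%n≡m; m%n<n; m≡m%n+[m/n]*n)
open import Data.Nat.Induction using (<-rec)
open import Data.Nat.Properties
open import Data.Nat.Tactic.RingSolver using (solve-∀)
open import Data.Product.Base using (∃; ∃-syntax; _×_; _,_; proj₁; proj₂)
open import Data.Sum.Base using (inj₁; inj₂; [_,_]′)
open import Function.Base using (_∘_; flip; id)
open import Relation.Binary.PropositionalEquality using (_≡_; _≢_; refl; sym; trans; cong; cong₂; subst; module ≡-Reasoning)
open import Relation.Nullary using (¬_; yes; no; contradiction)
open import Relation.Nullary.Decidable using (dec-true; dec-false)

open RawRing polyRing using (1#; -_; rawSemiring) renaming (_*_ to _·_)
open RawSemiringDefinitions rawSemiring using (sum) renaming (_^_ to _^ᴾ_)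

-- Polynomials written as a single term.

Nonempty : Poly → Set
Nonempty p = ∃ (_∈ p)

empty : ∀ {p} → ¬ Nonempty p → p ≡ []
empty {[]}    _    = refl
empty {t ∷ p} none = contradiction (t , here refl) none

-- An equation of lists rather than of coefficients, so that products and degrees compute. The
-- unspecified coefficient absorbs all signs.
IsMonomial : Monomial → Poly → Set
IsMonomial m p = ∃[ c ] c ≢ 0ℤ × p ≡ (c , m) ∷ []

product-isMonomial : ∀ {m m′ p q} → IsMonomial m p → IsMonomial m′ q → IsMonomial (m ++ m′) (p · q)
product-isMonomial (c , c≢0 , refl) (d , d≢0 , refl) =
  c ℤ.* d , [ c≢0 , d≢0 ]′ ∘ ℤ.i*j≡0⇒i≡0∨j≡0 c , refl

x-isMonomial : ∀ v → IsMonomial (v ∷ []) (x v)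
x-isMonomial v = 1ℤ , (λ ()) , refl

sign-isMonomial : ∀ n → IsMonomial [] ((- 1#) ^ᴾ n)
sign-isMonomial zero    = 1ℤ , (λ ()) , refl
sign-isMonomial (suc n) = product-isMonomial (ℤ.- 1ℤ , (λ ()) , refl) (sign-isMonomial n)

factors-nonempty : ∀ s p q → Nonempty (s · (p · q)) → Nonempty p × Nonempty q
factors-nonempty s p q (_ , t∈)
  with _ , _ , _ , u∈pq , _ ← ∈-cartesianProductWith⁻ _*ₜ_ s (p · q) t∈
  with _ , _ , v∈p , w∈q , _ ← ∈-cartesianProductWith⁻ _*ₜ_ p q u∈pq
  = (_ , v∈p) , (_ , w∈q)

sum-nonempty : ∀ {n} (f : Fin n → Poly) → Nonempty (sum f) → ∃[ j ] Nonempty (f j)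
sum-nonempty {suc n} f (t , t∈) with ∈-++⁻ (f zero) t∈
... | inj₁ t∈f₀ = zero , t , t∈f₀
... | inj₂ t∈fₛ with j , ne ← sum-nonempty (f ∘ suc) (t , t∈fₛ) = suc j , ne

sum-single : ∀ {n} (f : Fin n → Poly) j → (∀ i → Nonempty (f i) → i ≡ j) → sum f ≡ f j
sum-single {suc n} f zero only = begin
  f zero ++ sum (f ∘ suc) ≡⟨ cong (f zero ++_) (empty (none ∘ sum-nonempty (f ∘ suc))) ⟩
  f zero ++ []            ≡⟨ ++-identityʳ (f zero) ⟩
  f zero                  ∎
  where
  open ≡-Reasoning
  none : ¬ (∃[ i ] Nonempty (f (suc i)))
  none (i , ne) with () ← only (suc i) ne
sum-single {suc n} f (suc j) only = begin
  f zero ++ sum (f ∘ suc) ≡⟨ cong (_++ sum (f ∘ suc)) (empty (λ ne → Fin.0≢1+n (only zero ne))) ⟩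
  sum (f ∘ suc)           ≡⟨ sum-single (f ∘ suc) j (λ i → Fin.suc-injective ∘ only (suc i)) ⟩
  f (suc j)               ∎
  where open ≡-Reasoning

-- Laplace expansion and transversals.

module _ {n} (M : Fin (suc n) → Fin (suc n) → Poly) where

  minor : Fin (suc n) → Fin n → Fin n → Poly
  minor j r s = M (suc r) (punchIn j s)

  laplaceTerm : Fin (suc n) → Poly
  laplaceTerm j = ((- 1#) ^ᴾ toℕ j) · (M zero j · det polyRing n (minor j))

Transversal : ∀ {n} → (Fin n → Fin n → Poly) → Permutation′ n → Set
Transversal M π = ∀ r → Nonempty (M r (π ⟨$⟩ʳ r))

insert-transversal : ∀ {n} (M : Fin (suc n) → Fin (suc n) → Poly) j {τ} →
  Nonempty (M zero j) → Transversal (minor M j) τ → Transversal M (insert zero j τ)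
insert-transversal M j {τ} ne t zero    = ne
insert-transversal M j {τ} ne t (suc r) =
  subst (Nonempty ∘ M (suc r)) (sym (insert-punchIn zero j τ r)) (t r)

-- A nonempty Laplace term has a nonempty entry in the first row and a nonempty cofactor; recursion
-- gives a transversal of the minor, which that entry extends.
det-nonempty : ∀ n (M : Fin n → Fin n → Poly) → Nonempty (det polyRing n M) → ∃ (Transversal M)
det-nonempty zero    M _  = idₚ , λ ()
det-nonempty (suc n) M ne
  with j , neⱼ ← sum-nonempty (laplaceTerm M) ne
  with entry , cofactor ← factors-nonempty ((- 1#) ^ᴾ toℕ j) (M zero j) (det polyRing n (minor M j)) neⱼ
  with τ , t ← det-nonempty n (minor M j) cofactor
  = insert zero j τ , insert-transversal M j entry t

-- Multiplying lists of terms never cancels anything, so a single contributing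
-- permutation leaves literally a one-element list.
det-isMonomial : ∀ n (M : Fin n → Fin n → Poly) (v : Fin n → ℕ) (π : Permutation′ n) →
  (∀ r → M r (π ⟨$⟩ʳ r) ≡ x (v r)) →
  (∀ τ → Transversal M τ → ∀ r → τ ⟨$⟩ʳ r ≡ π ⟨$⟩ʳ r) →
  IsMonomial (tabulate v) (det polyRing n M)
det-isMonomial zero    M v π entries unique = 1ℤ , (λ ()) , refl
det-isMonomial (suc n) M v π entries unique =
  subst (IsMonomial (tabulate v)) (sym (sum-single (laplaceTerm M) j₀ only))
    -- The resulting list `[] ++ (v zero ∷ []) ++ tabulate (v ∘ suc)` reduces to `tabulate v`.
    (product-isMonomial (sign-isMonomial (toℕ j₀))
      (product-isMonomial
        (subst (IsMonomial _) (sym (entries zero)) (x-isMonomial (v zero)))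
        (det-isMonomial n (minor M j₀) (v ∘ suc) (remove zero π) minor-entries minor-unique)))
  where
  j₀ = π ⟨$⟩ʳ zero

  -- Another contributing column would complete to a transversal of M that disagrees with π in the
  -- first row.
  only : ∀ j → Nonempty (laplaceTerm M j) → j ≡ j₀
  only j ne
    with entry , cofactor ← factors-nonempty ((- 1#) ^ᴾ toℕ j) (M zero j) (det polyRing n (minor M j)) ne
    with τ , t ← det-nonempty n (minor M j) cofactor
    = unique (insert zero j τ) (insert-transversal M j entry t) zero

  minor-entries : ∀ r → minor M j₀ r (remove zero π ⟨$⟩ʳ r) ≡ x (v (suc r))
  minor-entries r = trans (cong (M (suc r)) (sym (punchIn-permute π zero r))) (entries (suc r))

  minor-unique : ∀ τ → Transversal (minor M j₀) τ → ∀ r → τ ⟨$⟩ʳ r ≡ remove zero π ⟨$⟩ʳ r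
  minor-unique τ t r = Fin.punchIn-injective j₀ _ _ (begin
    punchIn j₀ (τ ⟨$⟩ʳ r)                ≡⟨ insert-punchIn zero j₀ τ r ⟨
    insert zero j₀ τ ⟨$⟩ʳ suc r          ≡⟨ unique (insert zero j₀ τ) (insert-transversal M j₀ entry t) (suc r) ⟩
    π ⟨$⟩ʳ suc r                         ≡⟨ punchIn-permute π zero r ⟩
    punchIn j₀ (remove zero π ⟨$⟩ʳ r)    ∎)
    where
    open ≡-Reasoning
    entry : Nonempty (M zero j₀)
    entry = subst Nonempty (sym (entries zero)) (_ , here refl)

degree-isMonomial : ∀ {m p} v → IsMonomial m p → degree v p ≡ just (exponent v m)
degree-isMonomial {m} v (c , c≢0 , refl)
  -- The rewrites settle the tests in `coeff` and `support`: m matches itself, and its total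
  -- coefficient `c + 0` is nonzero.
  rewrite dec-true (m ≈ₘ? m) (λ _ → refl)
        | dec-false (c ℤ.+ 0ℤ ℤ.≟ 0ℤ) (c≢0 ∘ trans (sym (ℤ.+-identityʳ c)))
  = refl

-- Nonzero entries and the matchings they allow.

a-power : ∀ {n} → IsPowerOf2-1 n → a n ≡ x n
a-power {n} pow = cong (if_then x n else []) (dec-true (isPowerOf2-1? n) pow)

a-nonempty : ∀ n → Nonempty (a n) → IsPowerOf2-1 n
a-nonempty n (t , t∈) with isPowerOf2-1? n
... | yes pow = pow
... | no ¬pow with () ← subst (t ∈_) (cong (if_then x n else []) (dec-false (isPowerOf2-1? n) ¬pow)) t∈

-- A permutation of {0, ..., n - 1} as a relation on ℕ, so that transposing it or cutting it down to
-- a shorter interval needs no conversion between `Fin` types.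
record IsMatching (n : ℕ) (R : ℕ → ℕ → Set) : Set where
  field
    total      : ∀ {r} → r < n → ∃[ s ] R r s
    onto       : ∀ {s} → s < n → ∃[ r ] R r s
    functional : ∀ {r s s′} → R r s → R r s′ → s ≡ s′
    injective  : ∀ {r r′ s} → R r s → R r′ s → r ≡ r′
    domain     : ∀ {r s} → R r s → r < n
    range      : ∀ {r s} → R r s → s < n
    power      : ∀ {r s} → R r s → IsPowerOf2-1 (r + s + 1)

-- The matrix is symmetric, so facts about rows transfer to columns.
converse : ∀ {n R} → IsMatching n R → IsMatching n (flip R)
converse matching = record
  { total      = onto
  ; onto       = total
  ; functional = injective
  ; injective  = functional
  ; domain     = range
  ; range      = domain
  ; power      = λ {r} {s} Rsr → subst (λ t → IsPowerOf2-1 (t + 1)) (+-comm s r) (power Rsr)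
  }
  where open IsMatching matching

2^-cancel-< : ∀ {j k} → 2 ^ j < 2 ^ k → j < k
2^-cancel-< {j} {k} lt = ≰⇒> λ k≤j → <⇒≱ lt (^-monoʳ-≤ 2 k≤j)

-- Indices start from 0 from here on: r ↦ n + c − 1 − r reverses {c, …, n − 1}.
module Reflection m c i (eq : suc (c + i) ≡ 2 ^ m) where

  n : ℕ
  n = c + suc (i + i)

  2^[1+m] : 2 ^ suc m ≡ suc (n + c)
  2^[1+m] = trans (cong (2 *_) (sym eq)) (lemma c i)
    where
    lemma : ∀ c i → 2 * suc (c + i) ≡ suc (c + suc (i + i) + c)
    lemma = solve-∀

  n+c : n + c ≡ 2 ^ suc m ∸ 1
  n+c = cong (_∸ 1) (sym 2^[1+m])

  -- The power of two equal to r + s + 2 lies strictly between 2^m and 2^(m+2): above the former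
  -- because r ≥ c + i = 2^m - 1, below the latter because r, s < n < 2^(m+1).
  upper-sum : ∀ {r s} → c + i ≤ r → r < n → s < n → IsPowerOf2-1 (r + s + 1) → r + s + 1 ≡ n + c
  upper-sum {r} {s} c+i≤r r<n s<n (k , r+s+1≡) =
    trans r+s+1≡ (trans (cong (λ l → 2 ^ l ∸ 1) (≤-antisym (≤-pred k<2+m) m<k)) (sym n+c))
    where
    open ≤-Reasoning
    2^k : suc (r + s + 1) ≡ 2 ^ k
    2^k = trans (cong suc r+s+1≡) (m+[n∸m]≡n (m^n>0 2 k))
    m<k : m < k
    m<k = 2^-cancel-< (begin-strict
      2 ^ m           ≡⟨ eq ⟨
      suc (c + i)     ≤⟨ s≤s (≤-trans c+i≤r (m≤m+n r s)) ⟩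
      suc (r + s)     ≡⟨ +-comm 1 (r + s) ⟩
      r + s + 1       <⟨ n<1+n _ ⟩
      suc (r + s + 1) ≡⟨ 2^k ⟩
      2 ^ k           ∎)
    lemma : ∀ r s → suc (r + s + 1) ≡ suc r + suc s
    lemma = solve-∀
    n<2^[1+m] : n < 2 ^ suc m
    n<2^[1+m] = subst (n <_) (sym 2^[1+m]) (s≤s (m≤m+n n c))
    k<2+m : k < suc (suc m)
    k<2+m = 2^-cancel-< (begin-strict
      2 ^ k                     ≡⟨ 2^k ⟨
      suc (r + s + 1)           ≡⟨ lemma r s ⟩
      suc r + suc s             ≤⟨ +-mono-≤ r<n s<n ⟩
      n + n                     <⟨ +-mono-< n<2^[1+m] n<2^[1+m] ⟩
      2 ^ suc m + 2 ^ suc m     ≡⟨ cong (2 ^ suc m +_) (+-identityʳ (2 ^ suc m)) ⟨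
      2 ^ suc (suc m)           ∎)

  reflect : ∀ {r} → c ≤ r → r < n → ∃[ t ] c ≤ t × t < n × r + t + 1 ≡ n + c
  -- The mirror image n + c - 1 - r, arranged so that `r < n` prevents truncation and the bound by c
  -- from below is immediate.
  reflect {r} c≤r r<n = c + (n ∸ suc r) , m≤m+n c _ , t<n , eq′
    where
    open ≤-Reasoning
    lemma : ∀ r c d → r + (c + d) + 1 ≡ suc r + d + c
    lemma = solve-∀
    eq′ : r + (c + (n ∸ suc r)) + 1 ≡ n + c
    eq′ = trans (lemma r c (n ∸ suc r)) (cong (_+ c) (m+[n∸m]≡n r<n))
    t<n : c + (n ∸ suc r) < n
    t<n = begin-strict
      c + (n ∸ suc r)       <⟨ n<1+n _ ⟩
      suc c + (n ∸ suc r)   ≤⟨ +-monoˡ-≤ (n ∸ suc r) (s≤s c≤r) ⟩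
      suc r + (n ∸ suc r)   ≡⟨ m+[n∸m]≡n r<n ⟩
      n                     ∎

  suc-sum : ∀ r t → r + t + 1 ≡ suc (r + t)
  suc-sum r t = +-comm (r + t) 1

  sum-comm : ∀ r t → r + t + 1 ≡ t + r + 1
  sum-comm r t = cong (_+ 1) (+-comm r t)

  partner-unique : ∀ {r s t} → r + s + 1 ≡ n + c → r + t + 1 ≡ n + c → s ≡ t
  partner-unique {r} {s} {t} p q =
    +-cancelˡ-≡ r s t (+-cancelʳ-≡ 1 (r + s) (r + t) (trans p (sym q)))

  -- The centre of the reflection is c + i, since n + c - 1 = 2(c + i).
  partner-upper : ∀ {r t} → r < c + i → r + t + 1 ≡ n + c → c + i ≤ t
  partner-upper {r} {t} r<c+i p = +-cancelˡ-≤ (c + i) (c + i) t (≤-pred (begin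
    suc (c + i + (c + i))  ≡⟨ lemma c i ⟩
    n + c                  ≡⟨ p ⟨
    r + t + 1              ≡⟨ suc-sum r t ⟩
    suc (r + t)            ≤⟨ +-monoˡ-≤ t (≤-trans r<c+i (n≤1+n _)) ⟩
    suc (c + i + t)        ∎))
    where
    open ≤-Reasoning
    lemma : ∀ c i → suc (c + i + (c + i)) ≡ c + suc (i + i) + c
    lemma = solve-∀

  partner-≥ : ∀ {r s} → r + s + 1 ≡ n + c → r < n → c ≤ s
  partner-≥ {r} {s} p r<n = +-cancelˡ-≤ n c s (begin
    n + c      ≡⟨ p ⟨
    r + s + 1  ≡⟨ suc-sum r s ⟩
    suc r + s  ≤⟨ +-monoˡ-≤ s r<n ⟩
    n + s      ∎)
    where open ≤-Reasoning

  -- Rows from c + i on are covered by `upper-sum`. For a row r in between, the mirror image t is a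
  -- column in the upper half, so the transposed `upper-sum` shows that the row matched to t is r
  -- itself.
  upper-forced : ∀ {R r s} → IsMatching n R → c ≤ r → R r s → r + s + 1 ≡ n + c
  upper-forced {R} {r} {s} matching c≤r Rrs with c + i ≤? r
  ... | yes c+i≤r = upper-sum c+i≤r (domain Rrs) (range Rrs) (power Rrs)
    where open IsMatching matching
  ... | no  c+i≰r
    with t , c≤t , t<n , r+t ← reflect c≤r (IsMatching.domain matching Rrs)
    with q , Rqt ← IsMatching.onto matching t<n
    = trans (cong (λ u → r + u + 1) (functional Rrs Rrt)) r+t
    where
    open IsMatching matching
    t+q : t + q + 1 ≡ n + c
    t+q = upper-sum (partner-upper (≰⇒> c+i≰r) r+t) (range Rqt) (domain Rqt) (IsMatching.power (converse matching) Rqt)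
    Rrt : R r t
    Rrt = subst (λ u → R u t) (partner-unique t+q (trans (sum-comm t r) r+t)) Rqt

  -- A column s ≥ c is matched only to its mirror image, which is also at least c. Hence rows below
  -- c use columns below c, and conversely by transposition.
  restrict : ∀ {R} → IsMatching n R → IsMatching c (λ r s → R r s × r < c)
  restrict {R} matching = record
    { total      = λ r<c → let s , Rrs = total (<-≤-trans r<c (m≤m+n c _)) in s , Rrs , r<c
    ; onto       = λ s<c → let r , Rrs = onto (<-≤-trans s<c (m≤m+n c _)) in r , Rrs , lower (converse matching) Rrs s<c
    ; functional = λ (p , _) (q , _) → functional p q
    ; injective  = λ (p , _) (q , _) → injective p q
    ; domain     = proj₂
    ; range      = λ (p , r<c) → lower matching p r<c
    ; power      = power ∘ proj₁
    }
    where
    open IsMatching matching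
    lower : ∀ {S r s} → IsMatching n S → S r s → r < c → s < c
    lower {S} {r} {s} S-matching Srs r<c = ≰⇒> λ c≤s →
      <⇒≱ r<c (partner-≥ (upper-forced (converse S-matching) c≤s Srs) (IsMatching.range S-matching Srs))

-- Existence and uniqueness of the matching.

record UniqueMatching (n : ℕ) : Set₁ where
  field
    σ            : ℕ → ℕ
    σ-<          : ∀ {r} → r < n → σ r < n
    σ-involutive : ∀ {r} → r < n → σ (σ r) ≡ r
    σ-power      : ∀ {r} → r < n → IsPowerOf2-1 (r + σ r + 1)
    σ-unique     : ∀ {R r s} → IsMatching n R → R r s → s ≡ σ r

  -- Up to sign, D(n) is the product of the variables with these indices, one for each row.
  indices : List ℕ
  indices = applyUpTo (λ r → r + σ r + 1) n

applyUpTo-+ : ∀ {A : Set} (f : ℕ → A) m n → applyUpTo f (m + n) ≡ applyUpTo f m ++ applyUpTo (f ∘ (m +_)) n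
applyUpTo-+ f zero    n = refl
applyUpTo-+ f (suc m) n = cong (f 0 ∷_) (applyUpTo-+ (f ∘ suc) m n)

applyUpTo-cong-< : ∀ {A : Set} {f g : ℕ → A} n → (∀ {r} → r < n → f r ≡ g r) → applyUpTo f n ≡ applyUpTo g n
applyUpTo-cong-< zero    f≡g = refl
applyUpTo-cong-< (suc n) f≡g = cong₂ _∷_ (f≡g (s≤s z≤n)) (applyUpTo-cong-< n (f≡g ∘ s≤s))

applyUpTo-const : ∀ {A : Set} (y : A) n → applyUpTo (λ _ → y) n ≡ replicate n y
applyUpTo-const y zero    = refl
applyUpTo-const y (suc n) = cong (y ∷_) (applyUpTo-const y n)

applyUpTo-tabulate : ∀ {A : Set} (f : ℕ → A) n → applyUpTo f n ≡ tabulate {n = n} (f ∘ toℕ)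
applyUpTo-tabulate f zero    = refl
applyUpTo-tabulate f (suc n) = cong (f 0 ∷_) (applyUpTo-tabulate (f ∘ suc) n)

module Extension m c i (eq : suc (c + i) ≡ 2 ^ m) (inner : UniqueMatching c) where
  open Reflection m c i eq
  open UniqueMatching inner

  σ′ : ℕ → ℕ
  σ′ r with r <? c
  ... | yes _ = σ r
  ... | no  _ = c + (n ∸ suc r)

  σ′-lower : ∀ {r} → r < c → σ′ r ≡ σ r
  σ′-lower {r} r<c with r <? c
  ... | yes _   = refl
  ... | no  r≮c = contradiction r<c r≮c

  σ′-upper : ∀ {r} → c ≤ r → r < n → c ≤ σ′ r × σ′ r < n × r + σ′ r + 1 ≡ n + c
  σ′-upper {r} c≤r r<n with r <? c
  ... | yes r<c = contradiction c≤r (<⇒≱ r<c)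
  ... | no  _   = proj₂ (reflect c≤r r<n)

  extension : UniqueMatching n
  extension = record
    { σ            = σ′
    ; σ-<          = bound
    ; σ-involutive = involutive
    ; σ-power      = pow
    ; σ-unique     = unique
    }
    where
    bound : ∀ {r} → r < n → σ′ r < n
    bound {r} r<n with <-≤-connex r c
    ... | inj₁ r<c = subst (_< n) (sym (σ′-lower r<c)) (<-≤-trans (σ-< r<c) (m≤m+n c _))
    ... | inj₂ c≤r = proj₁ (proj₂ (σ′-upper c≤r r<n))

    involutive : ∀ {r} → r < n → σ′ (σ′ r) ≡ r
    involutive {r} r<n with <-≤-connex r c
    ... | inj₁ r<c = trans (cong σ′ (σ′-lower r<c)) (trans (σ′-lower (σ-< r<c)) (σ-involutive r<c))
    ... | inj₂ c≤r
      with c≤s , s<n , r+s ← σ′-upper c≤r r<n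
      with _ , _ , s+t ← σ′-upper c≤s s<n
      = partner-unique s+t (trans (sum-comm (σ′ r) r) r+s)

    pow : ∀ {r} → r < n → IsPowerOf2-1 (r + σ′ r + 1)
    pow {r} r<n with <-≤-connex r c
    ... | inj₁ r<c = subst (λ s → IsPowerOf2-1 (r + s + 1)) (sym (σ′-lower r<c)) (σ-power r<c)
    ... | inj₂ c≤r = suc m , trans (proj₂ (proj₂ (σ′-upper c≤r r<n))) n+c

    unique : ∀ {R r s} → IsMatching n R → R r s → s ≡ σ′ r
    unique {R} {r} {s} matching Rrs with <-≤-connex r c
    ... | inj₁ r<c = trans (σ-unique (restrict matching) (Rrs , r<c)) (sym (σ′-lower r<c))
    ... | inj₂ c≤r = partner-unique (upper-forced matching c≤r Rrs)
                       (proj₂ (proj₂ (σ′-upper c≤r (IsMatching.domain matching Rrs))))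

  -- Rows below c keep their partners, and each of the 2i + 1 reversed rows has the sum n + c =
  -- 2^(m+1) - 1.
  extension-indices : UniqueMatching.indices extension ≡ indices ++ replicate (suc (i + i)) (2 ^ suc m ∸ 1)
  extension-indices = begin
    applyUpTo f′ n                                              ≡⟨ applyUpTo-+ f′ c (suc (i + i)) ⟩
    applyUpTo f′ c ++ applyUpTo (f′ ∘ (c +_)) (suc (i + i))     ≡⟨ cong₂ _++_ lower upper ⟩
    indices ++ applyUpTo (λ _ → 2 ^ suc m ∸ 1) (suc (i + i))    ≡⟨ cong (indices ++_) (applyUpTo-const _ (suc (i + i))) ⟩
    indices ++ replicate (suc (i + i)) (2 ^ suc m ∸ 1)          ∎
    where
    open ≡-Reasoning
    f′ : ℕ → ℕ
    f′ r = r + σ′ r + 1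
    lower : applyUpTo f′ c ≡ indices
    lower = applyUpTo-cong-< c λ {r} r<c → cong (λ s → r + s + 1) (σ′-lower r<c)
    upper : applyUpTo (f′ ∘ (c +_)) (suc (i + i)) ≡ applyUpTo (λ _ → 2 ^ suc m ∸ 1) (suc (i + i))
    upper = applyUpTo-cong-< (suc (i + i)) λ {r} r<d →
      trans (proj₂ (proj₂ (σ′-upper (m≤m+n c r) (+-monoʳ-< c r<d)))) n+c

-- D(n) as a signed monomial.

D-isMonomial : ∀ {n} (u : UniqueMatching n) → IsMonomial (UniqueMatching.indices u) (D n)
D-isMonomial {n} u =
  subst (λ m → IsMonomial m (D n)) (sym (applyUpTo-tabulate index n))
    (det-isMonomial n entry (index ∘ toℕ) π entries unique)
  where
  open UniqueMatching u
  entry : Fin n → Fin n → Poly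
  entry i j = a (toℕ i + toℕ j + 1)

  index : ℕ → ℕ
  index r = r + σ r + 1

  to : Fin n → Fin n
  to r = fromℕ< (σ-< (Fin.toℕ<n r))

  toℕ-to : ∀ r → toℕ (to r) ≡ σ (toℕ r)
  toℕ-to r = Fin.toℕ-fromℕ< (σ-< (Fin.toℕ<n r))

  to-involutive : ∀ r → to (to r) ≡ r
  to-involutive r = Fin.toℕ-injective
    (trans (toℕ-to (to r)) (trans (cong σ (toℕ-to r)) (σ-involutive (Fin.toℕ<n r))))

  π : Permutation′ n
  π = permutation to to to-involutive to-involutive

  entries : ∀ r → entry r (to r) ≡ x (index (toℕ r))
  entries r = trans (cong (λ s → a (toℕ r + s + 1)) (toℕ-to r)) (a-power (σ-power (Fin.toℕ<n r)))

  unique : ∀ τ → Transversal entry τ → ∀ r → τ ⟨$⟩ʳ r ≡ to r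
  unique τ transversal r =
    Fin.toℕ-injective (trans (σ-unique graph-isMatching (r , refl , refl)) (sym (toℕ-to r)))
    where
    -- Quantifying over `f` builds the bounds into the relation, which puts an arbitrary transversal
    -- within reach of `σ-unique`.
    Graph : ℕ → ℕ → Set
    Graph r s = ∃[ f ] toℕ f ≡ r × toℕ (τ ⟨$⟩ʳ f) ≡ s

    graph-isMatching : IsMatching n Graph
    graph-isMatching = record
      { total      = λ r<n → _ , fromℕ< r<n , Fin.toℕ-fromℕ< r<n , refl
      ; onto       = λ s<n → _ , τ ⟨$⟩ˡ fromℕ< s<n , refl ,
                       trans (cong toℕ (inverseʳ τ)) (Fin.toℕ-fromℕ< s<n)
      ; functional = λ { (_ , refl , refl) (_ , f≡ , refl) →
                       cong (toℕ ∘ (τ ⟨$⟩ʳ_)) (Fin.toℕ-injective (sym f≡)) }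
      ; injective  = λ { (f , refl , refl) (g , refl , τg≡τf) → cong toℕ
                       (trans (sym (inverseˡ τ))
                         (trans (cong (τ ⟨$⟩ˡ_) (Fin.toℕ-injective (sym τg≡τf))) (inverseˡ τ))) }
      ; domain     = λ { (f , refl , _) → Fin.toℕ<n f }
      ; range      = λ { (f , _ , refl) → Fin.toℕ<n (τ ⟨$⟩ʳ f) }
      ; power      = λ { (f , refl , refl) → a-nonempty _ (transversal f) }
      }

-- Induction along the dyadic decomposition.

data Dyadic : ℕ → Set where
  dyadic : ∀ m c i → suc (c + i) ≡ 2 ^ m → Dyadic (c + suc (i + i))

-- The decomposition of n has 2^m as the largest power of two up to n, i = n - 2^m and c = 2^(m+1) -
-- 1 - n. Passing to n + 1 moves one unit from c to i; if c = 0, then n + 1 = 2^(m+1) and i restarts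
-- at 0.
dyadic-suc : ∀ n → Dyadic (suc n)
dyadic-suc zero = dyadic 0 0 0 refl
-- Abstracting `suc n` as well lets the index of `dyadic` unify with it.
dyadic-suc (suc n) with suc n | dyadic-suc n
... | _ | dyadic m zero    i eq =
  subst Dyadic (+-comm (suc (i + i)) 1) (dyadic (suc m) (suc (i + i)) 0 (trans (lemma i) (cong (2 *_) eq)))
  where
  lemma : ∀ i → suc (suc (i + i) + 0) ≡ 2 * suc i
  lemma = solve-∀
... | _ | dyadic m (suc c) i eq =
  subst Dyadic (lemma c i) (dyadic m c (suc i) (trans (cong suc (+-suc c i)) eq))
  where
  lemma : ∀ c i → c + suc (suc i + suc i) ≡ suc (suc c + suc (i + i))
  lemma = solve-∀

-- The recursion is well-founded because c is smaller than c + 2i + 1. Level polymorphism admits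
-- `UniqueMatching`, which lives in `Set₁`.
dyadic-induction : ∀ {ℓ} (P : ℕ → Set ℓ) → P 0 →
  (∀ m c i → suc (c + i) ≡ 2 ^ m → P c → P (c + suc (i + i))) → ∀ n → P n
dyadic-induction P base step = <-rec P cases
  where
  go : ∀ {n} → Dyadic n → (∀ {c} → c < n → P c) → P n
  go (dyadic m c i eq) rec = step m c i eq (rec (m<m+n c (s≤s z≤n)))
  cases : ∀ n → (∀ {c} → c < n → P c) → P n
  cases zero    _   = base
  cases (suc n) rec = go (dyadic-suc n) rec

uniqueMatching : ∀ n → UniqueMatching n
uniqueMatching = dyadic-induction UniqueMatching empty-matching Extension.extension
  where
  empty-matching : UniqueMatching 0
  empty-matching = record
    { σ            = id
    ; σ-<          = λ ()
    ; σ-involutive = λ ()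
    ; σ-power      = λ ()
    ; σ-unique     = λ matching Rrs → contradiction (IsMatching.domain matching Rrs) (λ ())
    }

-- Exponents along the decomposition.

exponent-++ : ∀ v m m′ → exponent v (m ++ m′) ≡ exponent v m + exponent v m′
exponent-++ v m m′ = trans (cong length (filter-++ (v ≟_) m m′)) (length-++ (filter (v ≟_) m))

exponent-replicate-≡ : ∀ v n → exponent v (replicate n v) ≡ n
exponent-replicate-≡ v n =
  trans (cong length (filter-all (v ≟_) (replicate⁺ n refl))) (length-replicate n)

exponent-replicate-≢ : ∀ {v w} n → v ≢ w → exponent v (replicate n w) ≡ 0
exponent-replicate-≢ {v} n v≢w = cong length (filter-none (v ≟_) (replicate⁺ n v≢w))

module _ m c i (eq : suc (c + i) ≡ 2 ^ m) where

  -- Any `UniqueMatching` determines D, so the `extension` of the matching for c can be used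
  -- directly, without unfolding the well-founded recursion in `uniqueMatching`.
  μ-step : ∀ k → ∃[ e ] μ k c ≡ just e ×
    μ k (c + suc (i + i)) ≡ just (e + exponent (2 ^ k ∸ 1) (replicate (suc (i + i)) (2 ^ suc m ∸ 1)))
  μ-step k = exponent v (indices inner) , degree-isMonomial v (D-isMonomial inner) , (begin
    μ k (c + suc (i + i))                           ≡⟨ degree-isMonomial v (D-isMonomial extension) ⟩
    just (exponent v (indices extension))           ≡⟨ cong (just ∘ exponent v) extension-indices ⟩
    just (exponent v (indices inner ++ block))      ≡⟨ cong just (exponent-++ v (indices inner) block) ⟩
    just (exponent v (indices inner) + exponent v block) ∎)
    where
    open ≡-Reasoning
    open UniqueMatching using (indices)
    inner = uniqueMatching c
    open Extension m c i eq inner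
    v = 2 ^ k ∸ 1
    block = replicate (suc (i + i)) (2 ^ suc m ∸ 1)

  μ-step-≡ : ∀ {e} → μ (suc m) c ≡ just e → μ (suc m) (c + suc (i + i)) ≡ just (e + suc (i + i))
  μ-step-≡ μc≡ with e , μc≡e , μn≡ ← μ-step (suc m) with refl ← trans (sym μc≡e) μc≡ =
    trans μn≡ (cong (just ∘ (e +_)) (exponent-replicate-≡ (2 ^ suc m ∸ 1) (suc (i + i))))

  -- The new factor is a power of the variable of index 2^(m+1) - 1, and distinct k give distinct
  -- indices 2^k - 1.
  μ-step-≢ : ∀ {k} → k ≢ suc m → μ k (c + suc (i + i)) ≡ μ k c
  μ-step-≢ {k} k≢ with e , μc≡e , μn≡ ← μ-step k = begin
    μ k (c + suc (i + i)) ≡⟨ μn≡ ⟩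
    _                     ≡⟨ cong (just ∘ (e +_)) (exponent-replicate-≢ (suc (i + i)) (k≢ ∘ 2^-1-injective)) ⟩
    just (e + 0)          ≡⟨ cong just (+-identityʳ e) ⟩
    just e                ≡⟨ μc≡e ⟨
    μ k c                 ∎
    where
    open ≡-Reasoning
    2^-1-injective : ∀ {j k} → 2 ^ j ∸ 1 ≡ 2 ^ k ∸ 1 → j ≡ k
    2^-1-injective {j} {k} eq′ with 2^j≡2^k ← ∸-cancelʳ-≡ (m^n>0 2 j) (m^n>0 2 k) eq′ =
      ≤-antisym (≮⇒≥ λ k<j → <⇒≢ (^-monoʳ-< 2 ≤-refl k<j) (sym 2^j≡2^k))
                (≮⇒≥ λ j<k → <⇒≢ (^-monoʳ-< 2 ≤-refl j<k) 2^j≡2^k)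

-- Vanishing, reflection and periodicity of the exponents.

μ-low : ∀ k n → n < 2 ^ k → μ (suc k) n ≡ just 0
μ-low k = dyadic-induction (λ n → n < 2 ^ k → μ (suc k) n ≡ just 0) (λ _ → refl) step
  where
  step : ∀ m c i → suc (c + i) ≡ 2 ^ m → (c < 2 ^ k → μ (suc k) c ≡ just 0) →
    c + suc (i + i) < 2 ^ k → μ (suc k) (c + suc (i + i)) ≡ just 0
  step m c i eq rec n<2^k =
    trans (μ-step-≢ m c i eq (<⇒≢ m<k ∘ sym ∘ suc-injective)) (rec (≤-<-trans (m≤m+n c _) n<2^k))
    where
    -- Since 2^m = c + i + 1 is at most c + 2i + 1 < 2^k, this step adds only the variable for m +
    -- 1, never the one for k + 1.
    m<k : m < k
    m<k = 2^-cancel-< (≤-<-trans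
      (≤-trans (≤-reflexive (sym eq)) (≤-trans (≤-reflexive (sym (+-suc c i))) (+-monoʳ-≤ c (s≤s (m≤m+n i i)))))
      n<2^k)

-- If b ≤ c, then b is what the decomposition with m = k leaves of c. So D(b) and D(c) differ only
-- by a sign and a power of the variable of index 2^(k+1) - 1.
μ-reflect : ∀ k b c → suc (b + c) ≡ 2 ^ suc k → μ k b ≡ μ k c
μ-reflect k b c eq = [ ordered b c eq , sym ∘ ordered c b (trans (cong suc (+-comm c b)) eq) ]′ (≤-total b c)
  where
  ordered : ∀ b c → suc (b + c) ≡ 2 ^ suc k → b ≤ c → μ k b ≡ μ k c
  ordered b c eq b≤c = let i , b+i = m≤n⇒∃[o]m+o≡n b<2^k in
    trans (sym (μ-step-≢ k b i b+i (<⇒≢ (n<1+n k)))) (cong (μ k) (+-cancelˡ-≡ (suc b) _ _ (begin-equality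
      suc b + (b + suc (i + i))  ≡⟨ lemma b i ⟩
      2 * suc (b + i)            ≡⟨ cong (2 *_) b+i ⟩
      2 ^ suc k                  ≡⟨ eq ⟨
      suc b + c                  ∎)))
    where
    open ≤-Reasoning
    lemma : ∀ b i → suc b + (b + suc (i + i)) ≡ 2 * suc (b + i)
    lemma = solve-∀
    b<2^k : b < 2 ^ k
    b<2^k = *-cancelˡ-< 2 b (2 ^ k) (begin-strict
      b + (b + 0)  ≡⟨ cong (b +_) (+-identityʳ b) ⟩
      b + b        ≤⟨ +-monoʳ-≤ b b≤c ⟩
      b + c        <⟨ n<1+n _ ⟩
      suc (b + c)  ≡⟨ eq ⟩
      2 ^ suc k    ∎)

-- The residues plus one still sum to a multiple of p, which is positive and less than 2p.
%-complement : ∀ p n c .{{_ : NonZero p}} → p ∣ suc (n + c) → suc (n % p + c % p) ≡ p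
%-complement p n c p∣ = exactly-once residues-divisible
  where
  open ≤-Reasoning
  residues-divisible : p ∣ suc (n % p + c % p)
  residues-divisible = ∣m+n∣m⇒∣n (subst (p ∣_) (trans
    (cong₂ (λ n c → suc (n + c)) (m≡m%n+[m/n]*n n p) (m≡m%n+[m/n]*n c p))
    (lemma (n % p) (n / p) (c % p) (c / p) p)) p∣) (n∣m*n (n / p + c / p))
    where
    lemma : ∀ r a s b p → suc (r + a * p + (s + b * p)) ≡ (a + b) * p + suc (r + s)
    lemma = solve-∀

  exactly-once : p ∣ suc (n % p + c % p) → suc (n % p + c % p) ≡ p
  exactly-once (divides (suc zero)    eq) = trans eq (*-identityˡ p)
  exactly-once (divides (suc (suc q)) eq) = contradiction eq (<⇒≢ (begin-strict
    suc (n % p + c % p)  ≤⟨ +-monoˡ-≤ (c % p) (m%n<n n p) ⟩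
    p + c % p            <⟨ +-monoʳ-< p (m%n<n c p) ⟩
    p + p                ≤⟨ +-monoʳ-≤ p (m≤m+n p (q * p)) ⟩
    p + (p + q * p)      ∎))

μ-mod : ∀ k n → μ k n ≡ μ k (_%_ n (2 ^ (k + 1)) {{m^n≢0 2 (k + 1)}})
μ-mod k = dyadic-induction (λ n → μ k n ≡ μ k (n % P)) (small (m^n>0 2 (k + 1))) step
  where
  P = 2 ^ (k + 1)
  instance
    P≢0 : NonZero P
    P≢0 = m^n≢0 2 (k + 1)

  small : ∀ {n} → n < P → μ k n ≡ μ k (n % P)
  small n<P = cong (μ k) (sym (m<n⇒m%n≡m n<P))

  step : ∀ m c i → suc (c + i) ≡ 2 ^ m → μ k c ≡ μ k (c % P) →
    μ k (c + suc (i + i)) ≡ μ k ((c + suc (i + i)) % P)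
  step m c i eq rec with <-≤-connex k m
  -- Here n < 2^(m+1) ≤ 2^(k+1), so n is its own residue.
  ... | inj₂ m≤k = small (<-≤-trans (subst (n <_) (sym 2^[1+m]) (s≤s (m≤m+n n c)))
                     (^-monoʳ-≤ 2 (subst (suc m ≤_) (+-comm 1 k) (s≤s m≤k))))
    where open Reflection m c i eq
  ... | inj₁ k<m = begin
    μ k n        ≡⟨ μ-step-≢ m c i eq (<⇒≢ (≤-trans k<m (n≤1+n m))) ⟩
    μ k c        ≡⟨ rec ⟩
    μ k (c % P)  ≡⟨ μ-reflect k (c % P) (n % P) (trans (cong suc (+-comm (c % P) (n % P)))
                      (trans (%-complement P n c P∣) (cong (2 ^_) (+-comm k 1)))) ⟩
    μ k (n % P)  ∎
    where
    open ≡-Reasoning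
    open Reflection m c i eq
    -- As n + c + 1 = 2^(m+1) is a multiple of 2^(k+1), the residues of n and c are exchanged by the
    -- reflection.
    P∣ : P ∣ suc (n + c)
    P∣ with d , k+1+d ← m≤n⇒∃[o]m+o≡n (subst (_≤ suc m) (+-comm 1 k) (≤-trans k<m (n≤1+n m))) =
      divides (2 ^ d) (trans (sym 2^[1+m])
        (trans (cong (2 ^_) (sym k+1+d))
          (trans (^-distribˡ-+-* 2 (k + 1) d) (*-comm P (2 ^ d)))))

theorem5p5 : (k : ℕ) → k ≥ 1 →
    ((i : ℕ) → i ≤ 2 ^ (k ∸ 1) ∸ 1 →
    (μ k i ≡ just 0)
    × (μ k (2 ^ (k ∸ 1) + i) ≡ just (2 * i + 1))
    × (μ k (2 ^ k + i) ≡ just (2 ^ k ∸ 2 * i ∸ 1))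
    × (μ k (2 ^ k + 2 ^ (k ∸ 1) + i) ≡ just 0))
    × ((n : ℕ) → n ≥ 2 ^ (k + 1) →
      μ k n ≡ μ k (_%_ n (2 ^ (k + 1)) {{m^n≢0 2 (k + 1)}}))
-- From here on k is one less than in the statement, so that `k ∸ 1` reduces away.
theorem5p5 (suc k) _ = values , λ n _ → μ-mod (suc k) n
  where
  values : (i : ℕ) → i ≤ 2 ^ k ∸ 1 →
    (μ (suc k) i ≡ just 0)
    × (μ (suc k) (2 ^ k + i) ≡ just (2 * i + 1))
    × (μ (suc k) (2 ^ suc k + i) ≡ just (2 ^ suc k ∸ 2 * i ∸ 1))
    × (μ (suc k) (2 ^ suc k + 2 ^ k + i) ≡ just 0)
  -- The complement j = 2^k - 1 - i serves as the smaller number c, or as part of it, in the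
  -- decompositions below.
  values i i≤ with j , i+j ← m≤n⇒∃[o]m+o≡n (≤-trans (s≤s i≤) (≤-reflexive (m+[n∸m]≡n (m^n>0 2 k)))) =
    μ-low k i i<p , rising i j j+i , falling , vanishing
    where
    open ≡-Reasoning
    p = 2 ^ k
    i<p : i < p
    i<p = subst (i <_) i+j (s≤s (m≤m+n i j))
    j+i : suc (j + i) ≡ p
    j+i = trans (cong suc (+-comm j i)) i+j

    -- Decompose p + i = j + (2i + 1) with m = k; D(j) contributes exponent 0. Both numbers are
    -- quantified because `falling` exchanges them.
    rising : ∀ i j → suc (j + i) ≡ p → μ (suc k) (p + i) ≡ just (2 * i + 1)
    rising i j eq = begin
      μ (suc k) (p + i)            ≡⟨ cong (λ q → μ (suc k) (q + i)) eq ⟨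
      μ (suc k) (suc (j + i) + i)  ≡⟨ cong (μ (suc k)) (lemma j i) ⟩
      μ (suc k) (j + suc (i + i))  ≡⟨ μ-step-≡ k j i eq (μ-low k j (subst (j <_) eq (s≤s (m≤m+n j i)))) ⟩
      just (suc (i + i))           ≡⟨ cong just (lemma′ i) ⟩
      just (2 * i + 1)             ∎
      where
      lemma : ∀ j i → suc (j + i) + i ≡ j + suc (i + i)
      lemma = solve-∀
      lemma′ : ∀ i → suc (i + i) ≡ 2 * i + 1
      lemma′ = solve-∀

    k≢ : suc k ≢ suc (suc k)
    k≢ = <⇒≢ (n<1+n (suc k))

    -- Decompose 2p + i = (p + j) + (2i + 1) with m = k + 1. The exponent is that of D(p + j),
    -- namely 2j + 1 = 2p - (2i + 1).
    falling : μ (suc k) (2 ^ suc k + i) ≡ just (2 ^ suc k ∸ 2 * i ∸ 1)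
    falling = begin
      μ (suc k) (2 * p + i)            ≡⟨ cong (λ q → μ (suc k) (2 * q + i)) i+j ⟨
      μ (suc k) (2 * suc (i + j) + i)  ≡⟨ cong (μ (suc k)) (lemma i j) ⟩
      μ (suc k) (suc (i + j) + j + suc (i + i))  ≡⟨ cong (λ q → μ (suc k) (q + j + suc (i + i))) i+j ⟩
      μ (suc k) (p + j + suc (i + i))  ≡⟨ μ-step-≢ (suc k) (p + j) i (trans (lemma′ p i j) (cong (λ q → p + (q + 0)) i+j)) k≢ ⟩
      μ (suc k) (p + j)                ≡⟨ rising j i i+j ⟩
      just (2 * j + 1)                 ≡⟨ cong just (m+n∸n≡m (2 * j + 1) (2 * i + 1)) ⟨
      just (2 * j + 1 + (2 * i + 1) ∸ (2 * i + 1))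
        ≡⟨ cong (λ q → just (q ∸ (2 * i + 1))) (trans (lemma″ i j) (cong (2 *_) i+j)) ⟩
      just (2 * p ∸ (2 * i + 1))       ≡⟨ cong just (∸-+-assoc (2 * p) (2 * i) 1) ⟨
      just (2 * p ∸ 2 * i ∸ 1)         ∎
      where
      lemma : ∀ i j → 2 * suc (i + j) + i ≡ suc (i + j) + j + suc (i + i)
      lemma = solve-∀
      lemma′ : ∀ p i j → suc (p + j + i) ≡ p + (suc (i + j) + 0)
      lemma′ = solve-∀
      lemma″ : ∀ i j → 2 * j + 1 + (2 * i + 1) ≡ 2 * suc (i + j)
      lemma″ = solve-∀

    -- Decompose 3p + i = j + (2(p + i) + 1) with m = k + 1, which leaves j < p.
    vanishing : μ (suc k) (2 ^ suc k + p + i) ≡ just 0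
    vanishing = begin
      μ (suc k) (2 * p + p + i)              ≡⟨ cong (μ (suc k)) (lemma p i) ⟩
      μ (suc k) (p + i + (p + p))            ≡⟨ cong (λ q → μ (suc k) (q + i + (p + p))) j+i ⟨
      μ (suc k) (suc (j + i) + i + (p + p))  ≡⟨ cong (μ (suc k)) (lemma′ p i j) ⟩
      μ (suc k) (j + suc (p + i + (p + i)))  ≡⟨ μ-step-≢ (suc k) j (p + i) (trans (lemma″ p i j) (cong (λ q → p + (q + 0)) i+j)) k≢ ⟩
      μ (suc k) j                            ≡⟨ μ-low k j (subst (j <_) j+i (s≤s (m≤m+n j i))) ⟩
      just 0                                 ∎
      where
      lemma : ∀ p i → 2 * p + p + i ≡ p + i + (p + p)
      lemma = solve-∀
      lemma′ : ∀ p i j → suc (j + i) + i + (p + p) ≡ j + suc (p + i + (p + i))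
      lemma′ = solve-∀
      lemma″ : ∀ p i j → suc (j + (p + i)) ≡ p + (suc (i + j) + 0)
      lemma″ = solve-∀
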